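{- For $n\in\{0,1,2,\dots\}$ let \[ d_n=\frac{(-1)^n}{n!}\sum_{k=0}^{n}(-1)^kS(n,k)(2k-3)!!. \] Then $d_n\ge0$ for every $n\in\mathbb{N}=\{1,2,\dots\}$.
   Context: $S(n,k)$ are the Stirling numbers of the second kind, given by $\frac{(e^x-1)^k}{k!}=\sum_{n\ge k}S(n,k)\frac{x^n}{n!}$. Double factorials: $(2j-1)!!=1\cdot3\cdots(2j-1)$ for $j\ge1$, and $[-(2j+1)]!!=(-1)^j/(2j-1)!!$ for $j\ge0$, so $(-1)!!=1$ and $(-3)!!=-1$. -}

module Defs where

open import Algebra.Definitions.RawSemiring using (_^_; sum)
open import Data.Fin.Base using (toℕ)
open import Data.Integer.Base as ℤ using (ℤ; +_; -[1+_])
open import Data.Nat.Base as ℕ using (ℕ; zero; suc; _!)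
open import Data.Nat.Properties using (_!≢0; m*n≢0)
open import Data.Rational.Base
  using (ℚ; 0ℚ; 1ℚ; _+_; _-_; _*_; _/_; -_; +-*-rawSemiring)

infixr 8 _^ℚ_

_^ℚ_ : ℚ → ℕ → ℚ
_^ℚ_ = _^_ +-*-rawSemiring

-- The bound is inclusive: ∑≤ n f = f 0 + f 1 + … + f n.
∑≤ : ℕ → (ℕ → ℚ) → ℚ
∑≤ n f = sum +-*-rawSemiring {suc n} (λ i → f (toℕ i))

fromℕ : ℕ → ℚ
fromℕ n = + n / 1

1/_! : ℕ → ℚ
1/ n ! = _/_ (+ 1) (n !) {{n !≢0}}

-- Formal power series over ℚ; a n is the coefficient of xⁿ.
Series : Set
Series = ℕ → ℚ

oneˢ : Series
oneˢ zero    = 1ℚ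
oneˢ (suc _) = 0ℚ

infixl 6 _-ˢ_
infixl 7 _*ˢ_
infixr 8 _^ˢ_

_-ˢ_ : Series → Series → Series
(a -ˢ b) n = a n - b n

_*ˢ_ : Series → Series → Series
(a *ˢ b) n = ∑≤ n (λ i → a i * b (n ℕ.∸ i))

_^ˢ_ : Series → ℕ → Series
a ^ˢ zero  = oneˢ
a ^ˢ suc k = a *ˢ (a ^ˢ k)

expˢ : Series
expˢ n = 1/ n !

-- Stirling numbers of the second kind, read off from the generating function
-- (eˣ - 1)ᵏ / k! = ∑ₙ S(n,k) xⁿ / n!.
S : ℕ → ℕ → ℚ
S n k = fromℕ (n !) * (1/ k ! * ((expˢ -ˢ oneˢ) ^ˢ k) n)

-- oddProduct j = 1 · 3 ⋯ (2j - 1)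
oddProduct : ℕ → ℕ
oddProduct zero    = 1
oddProduct (suc j) = oddProduct j ℕ.* suc (2 ℕ.* j)

oddProduct≢0 : ∀ j → ℕ.NonZero (oddProduct j)
oddProduct≢0 zero    = _
oddProduct≢0 (suc j) =
  m*n≢0 (oddProduct j) (suc (2 ℕ.* j)) {{oddProduct≢0 j}}

-- [2 j -1]!! is the double factorial of the odd integer 2j - 1, for any j : ℤ.
-- At the index -[1+ i ] that integer is -(2(i + 1) + 1), so the rule
-- [-(2m + 1)]!! = (-1)ᵐ / (2m - 1)!! applies with m = i + 1.
[2_-1]!! : ℤ → ℚ
[2 + j      -1]!! = fromℕ (oddProduct j)
[2 -[1+ i ] -1]!! =
  (- 1ℚ) ^ℚ suc i * _/_ (+ 1) (oddProduct (suc i)) {{oddProduct≢0 (suc i)}}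

-- The factor (2k - 3)!! is written as (2(k - 1) - 1)!!.
d : ℕ → ℚ
d n = ((- 1ℚ) ^ℚ n * 1/ n !) *
      ∑≤ n (λ k → (- 1ℚ) ^ℚ k * S n k * [2 (+ k ℤ.- + 1) -1]!!)

{-# OPTIONS --safe #-}

-- Put f = √(2e⁻ˣ - 1) and h = 1/f. The exponential generating function of
-- n! dₙ is -f, and f′ = -(f + h)/2, h′ = (h + h³)/2, so the derivatives
-- of the odd powers of h have nonnegative coefficients. With u = (f + h)/2 = (-f)′,
-- v = h - f and w = h³ - h one gets
--   u′ = (w + v)/4,   v′ = (h + h³)/2 + u,   w′ = (3h⁵ + h³ + w)/2,
-- a system with nonnegative coefficients and initial values u(0) = 1, v(0) = w(0) = 0.
-- Hence u, and with it every dₙ with n ≥ 1, is nonnegative.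
module Submission where

open import Defs
open import Algebra.Bundles using (CommutativeRing)
import Algebra.Properties.Semiring.Sum as Sum
open import Data.Integer.Base as ℤ using (+_)
import Data.Integer.Properties as ℤ
open import Data.Nat.Base using (ℕ; zero; suc; _!; z≤n; s≤s)
import Data.Nat.Base as ℕ
import Data.Nat.Properties as ℕ
open import Data.Rational.Base hiding (1/_)
open import Data.Rational.Properties
import Data.Rational.Unnormalised.Base as ℚᵘ
import Data.Rational.Unnormalised.Properties as ℚᵘ
open import Data.Rational.Solver using (module +-*-Solver)
open import Data.Fin.Base using (toℕ)
open import Function.Base using (_∘_)
open import Relation.Binary.PropositionalEquality
open +-*-Solver using (solve; _:=_; _:+_; _:*_; :-_; _:-_; con)
open Sum (CommutativeRing.semiring +-*-commutativeRing)
  using (∑-distrib-+; *-distribˡ-sum)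
open ≡-Reasoning

-- Naturals and inverse factorials in ℚ.

-- Passing to unnormalised fractions avoids the gcd reduction in `_/_`, so the identities below
-- become identities of integers.
toℚᵘ-/ : ∀ i n .{{_ : ℕ.NonZero n}} → toℚᵘ (i / n) ℚᵘ.≃ (i ℚᵘ./ n)
toℚᵘ-/ i (suc n) = toℚᵘ-fromℚᵘ (ℚᵘ.mkℚᵘ i n)

fromℕ-+ : ∀ m n → fromℕ (m ℕ.+ n) ≡ fromℕ m + fromℕ n
fromℕ-+ m n = toℚᵘ-injective
  (ℚᵘ.≃-trans (toℚᵘ-/ (+ (m ℕ.+ n)) 1)
  (ℚᵘ.≃-trans (ℚᵘ.*≡* (cong (ℤ._* + 1)
    (sym (cong₂ ℤ._+_ (ℤ.*-identityʳ (+ m)) (ℤ.*-identityʳ (+ n))))))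
  (ℚᵘ.≃-sym (ℚᵘ.≃-trans (toℚᵘ-homo-+ (fromℕ m) (fromℕ n))
    (ℚᵘ.+-cong (toℚᵘ-/ (+ m) 1) (toℚᵘ-/ (+ n) 1))))))

fromℕ-* : ∀ m n → fromℕ (m ℕ.* n) ≡ fromℕ m * fromℕ n
fromℕ-* m n = toℚᵘ-injective
  (ℚᵘ.≃-trans (toℚᵘ-/ (+ (m ℕ.* n)) 1)
  (ℚᵘ.≃-trans (ℚᵘ.*≡* (cong (ℤ._* + 1) (ℤ.pos-* m n)))
  (ℚᵘ.≃-sym (ℚᵘ.≃-trans (toℚᵘ-homo-* (fromℕ m) (fromℕ n))
    (ℚᵘ.*-cong (toℚᵘ-/ (+ m) 1) (toℚᵘ-/ (+ n) 1))))))

fromℕ-suc : ∀ n → fromℕ (suc n) ≡ 1ℚ + fromℕ n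
fromℕ-suc = fromℕ-+ 1

fromℕ-nonNeg : ∀ n → 0ℚ ≤ fromℕ n
fromℕ-nonNeg n = nonNegative⁻¹ (fromℕ n) {{normalize-nonNeg n 1}}

fromℕ-inverse : ∀ n .{{_ : ℕ.NonZero n}} → fromℕ n * (+ 1 / n) ≡ 1ℚ
fromℕ-inverse n@(suc _) = toℚᵘ-injective
  (ℚᵘ.≃-trans (toℚᵘ-homo-* (fromℕ n) (+ 1 / n))
  (ℚᵘ.≃-trans (ℚᵘ.*-cong (toℚᵘ-/ (+ n) 1) (toℚᵘ-/ (+ 1) n))
  (ℚᵘ.*≡* (trans (ℤ.*-identityʳ (+ n ℤ.* + 1)) (trans (ℤ.*-identityʳ (+ n))
    (sym (trans (ℤ.*-identityˡ (+ (1 ℕ.* n))) (cong +_ (ℕ.*-identityˡ n)))))))))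

1/!-nonNeg : ∀ n → 0ℚ ≤ 1/ n !
1/!-nonNeg n = nonNegative⁻¹ (1/ n !) {{normalize-nonNeg 1 (n !) {{n ℕ.!≢0}}}}

!-inverse : ∀ n → fromℕ (n !) * 1/ n ! ≡ 1ℚ
!-inverse n = fromℕ-inverse (n !) {{n ℕ.!≢0}}

1/!-suc : ∀ n → fromℕ (suc n) * 1/ suc n ! ≡ 1/ n !
1/!-suc n = begin
  s * r'               ≡⟨ *-identityʳ (s * r') ⟨
  -- The factor 1 is expanded as `n ! * 1/ n !`, so that `s * f` merges into `suc n !` and cancels
  -- against `r'`.
  s * r' * 1ℚ          ≡⟨ cong (s * r' *_) (!-inverse n) ⟨
  s * r' * (f * r)     ≡⟨ solve 4 (λ s r' f r → s :* r' :* (f :* r) := s :* f :* r' :* r) refl s r' f r ⟩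
  s * f * r' * r       ≡⟨ cong (λ t → t * r' * r) (fromℕ-* (suc n) (n !)) ⟨
  fromℕ (suc n !) * r' * r ≡⟨ cong (_* r) (!-inverse (suc n)) ⟩
  1ℚ * r               ≡⟨ *-identityˡ r ⟩
  r                    ∎
  where
  s = fromℕ (suc n)
  r' = 1/ suc n !
  f = fromℕ (n !)
  r = 1/ n !

-- Finite sums.

∑≤-cong : ∀ n {f g : ℕ → ℚ} → (∀ i → i ℕ.≤ n → f i ≡ g i) → ∑≤ n f ≡ ∑≤ n g
∑≤-cong zero    f≗g = cong (_+ 0ℚ) (f≗g 0 z≤n)
∑≤-cong (suc n) f≗g = cong₂ _+_ (f≗g 0 z≤n) (∑≤-cong n (λ i i≤n → f≗g (suc i) (s≤s i≤n)))

∑≤-+ : ∀ n (f g : ℕ → ℚ) → ∑≤ n (λ i → f i + g i) ≡ ∑≤ n f + ∑≤ n g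
∑≤-+ n f g = ∑-distrib-+ {suc n} (f ∘ toℕ) (g ∘ toℕ)

∑≤-* : ∀ n x (f : ℕ → ℚ) → ∑≤ n (λ i → x * f i) ≡ x * ∑≤ n f
∑≤-* n x f = sym (*-distribˡ-sum {suc n} x (f ∘ toℕ))

∑≤-last : ∀ n (f : ℕ → ℚ) → ∑≤ (suc n) f ≡ ∑≤ n f + f (suc n)
∑≤-last zero    f = solve 2 (λ a b → a :+ (b :+ con 0ℚ) := a :+ con 0ℚ :+ b) refl (f 0) (f 1)
∑≤-last (suc n) f = trans (cong (_+_ (f 0)) (∑≤-last n (f ∘ suc)))
  (sym (+-assoc (f 0) (∑≤ n (f ∘ suc)) (f (suc (suc n)))))

∑≤-zero : ∀ n → ∑≤ n (λ _ → 0ℚ) ≡ 0ℚ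
∑≤-zero n = trans (∑≤-cong n (λ _ _ → sym (*-zeroˡ 0ℚ)))
  (trans (∑≤-* n 0ℚ (λ _ → 0ℚ)) (*-zeroˡ (∑≤ n (λ _ → 0ℚ))))

-- Cauchy products and the Euler operator.

oneˢ-identityˡ : ∀ p n → (oneˢ *ˢ p) n ≡ p n
oneˢ-identityˡ p zero    = trans (+-identityʳ _) (*-identityˡ (p 0))
oneˢ-identityˡ p (suc n) = begin
  1ℚ * p (suc n) + ∑≤ n (λ i → 0ℚ * p (n ℕ.∸ i))
    ≡⟨ cong₂ _+_ (*-identityˡ (p (suc n)))
         (trans (∑≤-cong n (λ i _ → *-zeroˡ (p (n ℕ.∸ i)))) (∑≤-zero n)) ⟩
  p (suc n) + 0ℚ
    ≡⟨ +-identityʳ (p (suc n)) ⟩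
  p (suc n) ∎

term : Series → Series → ℕ → ℕ → ℚ
term a p n i = a i * p (n ℕ.∸ i)

-- The operator x d/dx.
θ : Series → Series
θ a n = fromℕ n * a n

-- Leibniz rule: in each term of the Cauchy product the weight `n` splits as `i + (n ∸ i)`. Unlike
-- d/dx, `θ` shifts no index.
θ-*ˢ : ∀ a p n → θ (a *ˢ p) n ≡ (θ a *ˢ p) n + (a *ˢ θ p) n
θ-*ˢ a p n = begin
  fromℕ n * ∑≤ n (λ i → a i * p (n ℕ.∸ i))
    ≡⟨ ∑≤-* n (fromℕ n) (term a p n) ⟨
  ∑≤ n (λ i → fromℕ n * (a i * p (n ℕ.∸ i)))
    ≡⟨ ∑≤-cong n leibniz ⟩
  ∑≤ n (λ i → θ a i * p (n ℕ.∸ i) + a i * θ p (n ℕ.∸ i))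
    ≡⟨ ∑≤-+ n (term (θ a) p n) (term a (θ p) n) ⟩
  (θ a *ˢ p) n + (a *ˢ θ p) n ∎
  where
  leibniz : ∀ i → i ℕ.≤ n → fromℕ n * (a i * p (n ℕ.∸ i)) ≡
            θ a i * p (n ℕ.∸ i) + a i * θ p (n ℕ.∸ i)
  leibniz i i≤n = begin
    fromℕ n * (a i * p j)
      ≡⟨ cong (λ m → fromℕ m * (a i * p j)) (ℕ.m+[n∸m]≡n i≤n) ⟨
    fromℕ (i ℕ.+ j) * (a i * p j)
      ≡⟨ cong (_* (a i * p j)) (fromℕ-+ i j) ⟩
    (fromℕ i + fromℕ j) * (a i * p j)
      ≡⟨ solve 4 (λ x y a p → (x :+ y) :* (a :* p) := x :* a :* p :+ a :* (y :* p)) refl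
           (fromℕ i) (fromℕ j) (a i) (p j) ⟩
    θ a i * p j + a i * θ p j ∎
    where j = n ℕ.∸ i

-- Powers of eˣ - 1 and their derivatives.

exp-1 : Series
exp-1 = expˢ -ˢ oneˢ

θ-exp-1 : ∀ n → θ exp-1 (suc n) ≡ exp-1 n + oneˢ n
θ-exp-1 n = begin
  fromℕ (suc n) * (1/ suc n ! - 0ℚ)
    ≡⟨ solve 2 (λ s r → s :* (r :- con 0ℚ) := s :* r) refl (fromℕ (suc n)) (1/ suc n !) ⟩
  fromℕ (suc n) * 1/ suc n !
    ≡⟨ 1/!-suc n ⟩
  1/ n !
    ≡⟨ solve 2 (λ r o → r := r :- o :+ o) refl (1/ n !) (oneˢ n) ⟩
  exp-1 n + oneˢ n ∎

θ-exp-1-*ˢ : ∀ p n → (θ exp-1 *ˢ p) (suc n) ≡ (exp-1 *ˢ p) n + p n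
θ-exp-1-*ˢ p n = begin
  0ℚ * exp-1 0 * p (suc n) + ∑≤ n (λ i → θ exp-1 (suc i) * p (n ℕ.∸ i))
    ≡⟨ cong₂ _+_ (*-zeroˡ (p (suc n))) (∑≤-cong n (λ i _ →
         trans (cong (_* p (n ℕ.∸ i)) (θ-exp-1 i)) (*-distribʳ-+ (p (n ℕ.∸ i)) (exp-1 i) (oneˢ i)))) ⟩
  0ℚ + ∑≤ n (λ i → exp-1 i * p (n ℕ.∸ i) + oneˢ i * p (n ℕ.∸ i))
    ≡⟨ +-identityˡ _ ⟩
  ∑≤ n (λ i → exp-1 i * p (n ℕ.∸ i) + oneˢ i * p (n ℕ.∸ i))
    ≡⟨ ∑≤-+ n (term exp-1 p n) (term oneˢ p n) ⟩
  (exp-1 *ˢ p) n + (oneˢ *ˢ p) n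
    ≡⟨ cong (_+_ ((exp-1 *ˢ p) n)) (oneˢ-identityˡ p n) ⟩
  (exp-1 *ˢ p) n + p n ∎

-- The last term drops out because `θ p 0` is 0. In the others `θ p` is taken at a successor, where
-- `θ-exp-1-^` applies.
*ˢ-θ-suc : ∀ a p n → (a *ˢ θ p) (suc n) ≡ ∑≤ n (λ i → a i * θ p (suc (n ℕ.∸ i)))
*ˢ-θ-suc a p n = begin
  (a *ˢ θ p) (suc n)
    ≡⟨ ∑≤-last n (term a (θ p) (suc n)) ⟩
  ∑≤ n (λ i → a i * θ p (suc n ℕ.∸ i)) + a (suc n) * θ p (n ℕ.∸ n)
    ≡⟨ cong₂ _+_
         (∑≤-cong n (λ i i≤n → cong (λ m → a i * θ p m) (ℕ.+-∸-assoc 1 i≤n)))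
         (trans (cong (λ m → a (suc n) * θ p m) (ℕ.n∸n≡0 n))
                (solve 2 (λ a p → a :* (con 0ℚ :* p) := con 0ℚ) refl (a (suc n)) (p 0))) ⟩
  ∑≤ n (λ i → a i * θ p (suc (n ℕ.∸ i))) + 0ℚ
    ≡⟨ +-identityʳ _ ⟩
  ∑≤ n (λ i → a i * θ p (suc (n ℕ.∸ i))) ∎

-- ((eˣ - 1)ᵏ⁺¹)′ = (k + 1) ((eˣ - 1)ᵏ⁺¹ + (eˣ - 1)ᵏ)
θ-exp-1-^ : ∀ k n → θ (exp-1 ^ˢ suc k) (suc n) ≡
            fromℕ (suc k) * ((exp-1 ^ˢ suc k) n + (exp-1 ^ˢ k) n)
-- The second half of the Leibniz rule, proved by mutual induction: the case `suc k` applies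
-- `θ-exp-1-^ k` under the sum, and that calls this lemma at `k`.
exp-1-*ˢ-θ-^ : ∀ k n → (exp-1 *ˢ θ (exp-1 ^ˢ k)) (suc n) ≡
               fromℕ k * ((exp-1 ^ˢ suc k) n + (exp-1 ^ˢ k) n)

θ-exp-1-^ k n = begin
  θ (exp-1 *ˢ p) (suc n)
    ≡⟨ θ-*ˢ exp-1 p (suc n) ⟩
  (θ exp-1 *ˢ p) (suc n) + (exp-1 *ˢ θ p) (suc n)
    ≡⟨ cong₂ _+_ (θ-exp-1-*ˢ p n) (exp-1-*ˢ-θ-^ k n) ⟩
  q + fromℕ k * q
    ≡⟨ solve 2 (λ q k → q :+ k :* q := (con 1ℚ :+ k) :* q) refl q (fromℕ k) ⟩
  (1ℚ + fromℕ k) * q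
    ≡⟨ cong (_* q) (fromℕ-suc k) ⟨
  fromℕ (suc k) * q ∎
  where
  p = exp-1 ^ˢ k
  q = (exp-1 *ˢ p) n + p n

exp-1-*ˢ-θ-^ zero n = begin
  (exp-1 *ˢ θ oneˢ) (suc n)
    ≡⟨ *ˢ-θ-suc exp-1 oneˢ n ⟩
  ∑≤ n (λ i → exp-1 i * (fromℕ (suc (n ℕ.∸ i)) * 0ℚ))
    ≡⟨ ∑≤-cong n (λ i _ → solve 2 (λ a m → a :* (m :* con 0ℚ) := con 0ℚ) refl
         (exp-1 i) (fromℕ (suc (n ℕ.∸ i)))) ⟩
  ∑≤ n (λ _ → 0ℚ)
    ≡⟨ ∑≤-zero n ⟩
  0ℚ
    ≡⟨ *-zeroˡ ((exp-1 *ˢ oneˢ) n + oneˢ n) ⟨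
  0ℚ * ((exp-1 *ˢ oneˢ) n + oneˢ n) ∎
exp-1-*ˢ-θ-^ (suc k) n = begin
  (exp-1 *ˢ θ p) (suc n)
    ≡⟨ *ˢ-θ-suc exp-1 p n ⟩
  ∑≤ n (λ i → exp-1 i * θ p (suc (n ℕ.∸ i)))
    ≡⟨ ∑≤-cong n (λ i _ → trans (cong (exp-1 i *_) (θ-exp-1-^ k (n ℕ.∸ i)))
         (solve 4 (λ a c p q → a :* (c :* (p :+ q)) := c :* (a :* p :+ a :* q)) refl
           (exp-1 i) c (p (n ℕ.∸ i)) (q (n ℕ.∸ i)))) ⟩
  ∑≤ n (λ i → c * (exp-1 i * p (n ℕ.∸ i) + exp-1 i * q (n ℕ.∸ i)))
    ≡⟨ ∑≤-* n c (λ i → term exp-1 p n i + term exp-1 q n i) ⟩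
  c * ∑≤ n (λ i → exp-1 i * p (n ℕ.∸ i) + exp-1 i * q (n ℕ.∸ i))
    ≡⟨ cong (c *_) (∑≤-+ n (term exp-1 p n) (term exp-1 q n)) ⟩
  c * ((exp-1 *ˢ p) n + p n) ∎
  where
  c = fromℕ (suc k)
  p = exp-1 ^ˢ suc k
  q = exp-1 ^ˢ k

-- Recurrence for the Stirling numbers.

-- Comparison of coefficients in `θ-exp-1-^`, scaled by n!/(k+1)!; the factor k+1 turns 1/(k+1)!
-- into 1/k! in the second term.
S-suc-suc : ∀ n k → S (suc n) (suc k) ≡ fromℕ (suc k) * S n (suc k) + S n k
S-suc-suc n k = begin
  fromℕ (suc n !) * (r' * p (suc n))
    ≡⟨ cong (_* (r' * p (suc n))) (fromℕ-* (suc n) (n !)) ⟩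
  fromℕ (suc n) * f * (r' * p (suc n))
    ≡⟨ solve 4 (λ s f r' p → s :* f :* (r' :* p) := f :* r' :* (s :* p)) refl
         (fromℕ (suc n)) f r' (p (suc n)) ⟩
  f * r' * θ p (suc n)
    ≡⟨ cong (f * r' *_) (θ-exp-1-^ k n) ⟩
  f * r' * (c * (p n + q n))
    ≡⟨ solve 5 (λ f r' c p q → f :* r' :* (c :* (p :+ q)) :=
         c :* (f :* (r' :* p)) :+ f :* ((c :* r') :* q)) refl f r' c (p n) (q n) ⟩
  c * S n (suc k) + f * (c * r' * q n)
    ≡⟨ cong (λ r → c * S n (suc k) + f * (r * q n)) (1/!-suc k) ⟩
  c * S n (suc k) + S n k ∎
  where
  f = fromℕ (n !)
  r' = 1/ suc k !
  c = fromℕ (suc k)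
  p = exp-1 ^ˢ suc k
  q = exp-1 ^ˢ k

S-suc-zero : ∀ n → S (suc n) 0 ≡ 0ℚ
S-suc-zero n = solve 1 (λ f → f :* (con 1ℚ :* con 0ℚ) := con 0ℚ) refl (fromℕ (suc n !))

S-zero-suc : ∀ k → S 0 (suc k) ≡ 0ℚ
S-zero-suc k = solve 2 (λ r q → con 1ℚ :* (r :* (con 0ℚ :* q :+ con 0ℚ)) := con 0ℚ) refl
  (1/ suc k !) ((exp-1 ^ˢ k) 0)

S-< : ∀ {n k} → n ℕ.< k → S n k ≡ 0ℚ
S-< {zero}  {suc k} _         = S-zero-suc k
S-< {suc n} {suc k} (s≤s n<k) = begin
  S (suc n) (suc k)
    ≡⟨ S-suc-suc n k ⟩
  fromℕ (suc k) * S n (suc k) + S n k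
    ≡⟨ cong₂ (λ a b → fromℕ (suc k) * a + b) (S-< (ℕ.m<n⇒m<1+n n<k)) (S-< n<k) ⟩
  fromℕ (suc k) * 0ℚ + 0ℚ
    ≡⟨ solve 1 (λ c → c :* con 0ℚ :+ con 0ℚ := con 0ℚ) refl (fromℕ (suc k)) ⟩
  0ℚ ∎

-- The signed Stirling transform and differentiation.

sgn : ℕ → ℚ
sgn n = (- 1ℚ) ^ℚ n

-- T n c is n! times the coefficient of xⁿ in ∑ₖ cₖ yᵏ / k!, where y = 1 - e⁻ˣ;
-- on the coefficients cₖ, d/dx = (1 - y) d/dy acts as D.
T : ℕ → (ℕ → ℚ) → ℚ
T n c = sgn n * ∑≤ n (λ k → sgn k * S n k * c k)

D : (ℕ → ℚ) → (ℕ → ℚ)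
D c k = c (suc k) - fromℕ k * c k

T-zero : ∀ c → T 0 c ≡ c 0
T-zero c = solve 1 (λ x → con 1ℚ :* (con 1ℚ :* con 1ℚ :* x :+ con 0ℚ) := x) refl (c 0)

-- The Stirling recurrence splits the sum in two. Moving the part k S(n,k) down by one index lets
-- both parts be collected as multiples of S(n,k), with coefficient `D c k`.
T-suc : ∀ n c → T (suc n) c ≡ T n (D c)
T-suc n c = begin
  - 1ℚ * sgn n * (1ℚ * S (suc n) 0 * c 0 + ∑≤ n (λ k → sgn (suc k) * S (suc n) (suc k) * c (suc k)))
    ≡⟨ cong₂ (λ s t → - 1ℚ * sgn n * (1ℚ * s * c 0 + t)) (S-suc-zero n)
         (∑≤-cong n (λ k _ → expand k)) ⟩
  - 1ℚ * sgn n * (1ℚ * 0ℚ * c 0 + ∑≤ n (λ k → g (suc k) + h k))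
    ≡⟨ cong (λ t → - 1ℚ * sgn n * (1ℚ * 0ℚ * c 0 + t)) (∑≤-+ n (g ∘ suc) h) ⟩
  - 1ℚ * sgn n * (1ℚ * 0ℚ * c 0 + (∑≤ n (g ∘ suc) + ∑≤ n h))
    ≡⟨ cong (λ t → - 1ℚ * sgn n * (1ℚ * 0ℚ * c 0 + (t + ∑≤ n h))) shift ⟩
  - 1ℚ * sgn n * (1ℚ * 0ℚ * c 0 + (∑≤ n g + ∑≤ n h))
    ≡⟨ solve 4 (λ s x y z → (:- con 1ℚ) :* s :* (con 1ℚ :* con 0ℚ :* z :+ (x :+ y)) :=
         s :* ((:- con 1ℚ) :* (x :+ y))) refl (sgn n) (∑≤ n g) (∑≤ n h) (c 0) ⟩
  sgn n * (- 1ℚ * (∑≤ n g + ∑≤ n h))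
    ≡⟨ cong (λ t → sgn n * (- 1ℚ * t)) (∑≤-+ n g h) ⟨
  sgn n * (- 1ℚ * ∑≤ n (λ k → g k + h k))
    ≡⟨ cong (sgn n *_) (∑≤-* n (- 1ℚ) (λ k → g k + h k)) ⟨
  sgn n * ∑≤ n (λ k → - 1ℚ * (g k + h k))
    ≡⟨ cong (sgn n *_) (∑≤-cong n (λ k _ → collect k)) ⟩
  T n (D c) ∎
  where
  g h : ℕ → ℚ
  g k = sgn k * (fromℕ k * S n k) * c k
  h k = sgn (suc k) * S n k * c (suc k)

  expand : ∀ k → sgn (suc k) * S (suc n) (suc k) * c (suc k) ≡ g (suc k) + h k
  expand k = trans (cong (λ s → sgn (suc k) * s * c (suc k)) (S-suc-suc n k))
    (solve 4 (λ e x y z → e :* (x :+ y) :* z := e :* x :* z :+ e :* y :* z) refl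
      (sgn (suc k)) (fromℕ (suc k) * S n (suc k)) (S n k) (c (suc k)))

  -- Both boundary terms vanish: index 0 carries the factor `fromℕ 0`, and index n+1 carries
  -- S(n,n+1) = 0.
  shift : ∑≤ n (g ∘ suc) ≡ ∑≤ n g
  shift = begin
    ∑≤ n (g ∘ suc)
      ≡⟨ solve 3 (λ x s z → x := con 1ℚ :* (con 0ℚ :* s) :* z :+ x) refl (∑≤ n (g ∘ suc)) (S n 0) (c 0) ⟩
    ∑≤ (suc n) g
      ≡⟨ ∑≤-last n g ⟩
    ∑≤ n g + sgn (suc n) * (fromℕ (suc n) * S n (suc n)) * c (suc n)
      ≡⟨ cong (λ s → ∑≤ n g + sgn (suc n) * (fromℕ (suc n) * s) * c (suc n)) (S-< (ℕ.n<1+n n)) ⟩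
    ∑≤ n g + sgn (suc n) * (fromℕ (suc n) * 0ℚ) * c (suc n)
      ≡⟨ solve 4 (λ x e m z → x :+ e :* (m :* con 0ℚ) :* z := x) refl
           (∑≤ n g) (sgn (suc n)) (fromℕ (suc n)) (c (suc n)) ⟩
    ∑≤ n g ∎

  collect : ∀ k → - 1ℚ * (g k + h k) ≡ sgn k * S n k * D c k
  collect k = solve 5 (λ e m s x y →
    (:- con 1ℚ) :* (e :* (m :* s) :* x :+ (:- con 1ℚ) :* e :* s :* y) :=
    e :* s :* (y :- m :* x)) refl (sgn k) (fromℕ k) (S n k) (c k) (c (suc k))

-- Coefficient sequences built from double factorials.

-- In this correspondence E j is (2j - 1)!! h²ʲ⁺¹ and G is -f; below, W is w,
-- D G is u and E 0 ⊕ G is v.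
E : ℕ → ℕ → ℚ
E j k = fromℕ (oddProduct (j ℕ.+ k))

G : ℕ → ℚ
G k = [2 (+ k ℤ.- + 1) -1]!!

oddProduct-step : ∀ m → fromℕ (oddProduct (suc m)) ≡ fromℕ (oddProduct m) * (1ℚ + (1ℚ + 1ℚ) * fromℕ m)
oddProduct-step m = begin
  fromℕ (oddProduct m ℕ.* suc (2 ℕ.* m))
    ≡⟨ fromℕ-* (oddProduct m) (suc (2 ℕ.* m)) ⟩
  fromℕ (oddProduct m) * fromℕ (suc (2 ℕ.* m))
    ≡⟨ cong (fromℕ (oddProduct m) *_) (trans (fromℕ-suc (2 ℕ.* m)) (cong (_+_ 1ℚ) (fromℕ-* 2 m))) ⟩
  fromℕ (oddProduct m) * (1ℚ + (1ℚ + 1ℚ) * fromℕ m) ∎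

E-suc : ∀ j k → E (suc j) k ≡ E j k * (1ℚ + (1ℚ + 1ℚ) * (fromℕ j + fromℕ k))
E-suc j k = trans (oddProduct-step (j ℕ.+ k))
  (cong (λ t → E j k * (1ℚ + (1ℚ + 1ℚ) * t)) (fromℕ-+ j k))

E-shift : ∀ j k → E j (suc k) ≡ E (suc j) k
E-shift j k = cong (fromℕ ∘ oddProduct) (ℕ.+-suc j k)

-- At k = 0 this rests on (-3)!! = -1. At a successor `G (suc k)` computes to `E 0 k`, which leaves
-- one step of the odd product.
E₀-G : ∀ k → E 0 k ≡ G k * ((1ℚ + 1ℚ) * fromℕ k - 1ℚ)
E₀-G zero    = refl
E₀-G (suc k) = trans (oddProduct-step k)
  (trans (solve 2 (λ g m → g :* (con 1ℚ :+ con (1ℚ + 1ℚ) :* m) :=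
           g :* (con (1ℚ + 1ℚ) :* (con 1ℚ :+ m) :- con 1ℚ)) refl (G (suc k)) (fromℕ k))
         (cong (λ t → G (suc k) * ((1ℚ + 1ℚ) * t - 1ℚ)) (sym (fromℕ-suc k))))

-- A cone of sequences stable under `D`.

¼ : ℚ
¼ = ½ * ½

infixl 6 _⊕_
_⊕_ : (ℕ → ℚ) → (ℕ → ℚ) → (ℕ → ℚ)
(a ⊕ b) k = a k + b k

infixr 7 _⊙_
_⊙_ : ℚ → (ℕ → ℚ) → (ℕ → ℚ)
(q ⊙ a) k = q * a k

W : ℕ → ℚ
W k = E 1 k - E 0 k

-- Nonnegative combinations of the functions in the differential system. `≗-cone` is included
-- because the formulas for `D` are pointwise equalities.
data Cone : (ℕ → ℚ) → Set where
  E-cone   : ∀ j → Cone (E j)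
  W-cone   : Cone W
  DG-cone  : Cone (D G)
  EG-cone  : Cone (E 0 ⊕ G)
  ⊕-cone   : ∀ {a b} → Cone a → Cone b → Cone (a ⊕ b)
  ⊙-cone   : ∀ {q a} → 0ℚ ≤ q → Cone a → Cone (q ⊙ a)
  ≗-cone   : ∀ {a b} → a ≗ b → Cone a → Cone b

+-nonNeg : ∀ {p q} → 0ℚ ≤ p → 0ℚ ≤ q → 0ℚ ≤ p + q
+-nonNeg = +-mono-≤

*-nonNeg : ∀ {p q} → 0ℚ ≤ p → 0ℚ ≤ q → 0ℚ ≤ p * q
*-nonNeg {p} {q} 0≤p 0≤q = nonNegative⁻¹ (p * q)
  {{nonNeg*nonNeg⇒nonNeg p {{nonNegative 0≤p}} q {{nonNegative 0≤q}}}}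

½-nonNeg : 0ℚ ≤ ½
½-nonNeg = nonNegative⁻¹ ½

¼-nonNeg : 0ℚ ≤ ¼
¼-nonNeg = nonNegative⁻¹ ¼

-- By `E-suc`, k `E j k` is half of `E (suc j) k` minus (1 + 2j) `E j k`, while `E j (suc k)` is
-- `E (suc j) k`. For j = 0 this is h′ = (h + h³)/2.
D-E : ∀ j → (½ ⊙ (E (suc j) ⊕ (1ℚ + (1ℚ + 1ℚ) * fromℕ j) ⊙ E j)) ≗ D (E j)
D-E j k = begin
  ½ * (E (suc j) k + (1ℚ + (1ℚ + 1ℚ) * fromℕ j) * E j k)
    ≡⟨ cong (λ t → ½ * (t + (1ℚ + (1ℚ + 1ℚ) * fromℕ j) * E j k)) (E-suc j k) ⟩
  ½ * (E j k * (1ℚ + (1ℚ + 1ℚ) * (fromℕ j + fromℕ k)) + (1ℚ + (1ℚ + 1ℚ) * fromℕ j) * E j k)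
    ≡⟨ solve 3 (λ e j k →
         con ½ :* (e :* (con 1ℚ :+ con (1ℚ + 1ℚ) :* (j :+ k)) :+ (con 1ℚ :+ con (1ℚ + 1ℚ) :* j) :* e) :=
         e :* (con 1ℚ :+ con (1ℚ + 1ℚ) :* (j :+ k)) :- k :* e) refl (E j k) (fromℕ j) (fromℕ k) ⟩
  E j k * (1ℚ + (1ℚ + 1ℚ) * (fromℕ j + fromℕ k)) - fromℕ k * E j k
    ≡⟨ cong (_- fromℕ k * E j k) (sym (trans (E-shift j k) (E-suc j k))) ⟩
  D (E j) k ∎

D-⊕ : ∀ a b → (D a ⊕ D b) ≗ D (a ⊕ b)
D-⊕ a b k = solve 5 (λ m x y z w → x :- m :* y :+ (z :- m :* w) := x :+ z :- m :* (y :+ w)) refl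
  (fromℕ k) (a (suc k)) (a k) (b (suc k)) (b k)

D-⊙ : ∀ q a → (q ⊙ D a) ≗ D (q ⊙ a)
D-⊙ q a k = solve 4 (λ q m x y → q :* (x :- m :* y) := q :* x :- m :* (q :* y)) refl
  q (fromℕ k) (a (suc k)) (a k)

D-cong : ∀ {a b} → a ≗ b → D a ≗ D b
D-cong a≗b k = cong₂ (λ x y → x - fromℕ k * y) (a≗b (suc k)) (a≗b k)

D-W : (½ ⊙ (E 2 ⊕ E 1 ⊕ W)) ≗ D W
D-W k = begin
  ½ * (E 2 k + E 1 k + (E 1 k - E 0 k))
    -- The difference of the two instances of `D-E` is (E₂ + 2E₁ - E₀)/2; one copy of E₁ absorbs -E₀
    -- into `W`.
    ≡⟨ solve 3 (λ x y z →
         con ½ :* (x :+ y :+ (y :- z)) :=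
         con ½ :* (x :+ (con 1ℚ :+ con (1ℚ + 1ℚ) :* con 1ℚ) :* y) :-
         con ½ :* (y :+ (con 1ℚ :+ con (1ℚ + 1ℚ) :* con 0ℚ) :* z)) refl
         (E 2 k) (E 1 k) (E 0 k) ⟩
  ½ * (E 2 k + (1ℚ + (1ℚ + 1ℚ) * fromℕ 1) * E 1 k) -
  ½ * (E 1 k + (1ℚ + (1ℚ + 1ℚ) * fromℕ 0) * E 0 k)
    ≡⟨ cong₂ _-_ (D-E 1 k) (D-E 0 k) ⟩
  D (E 1) k - D (E 0) k
    ≡⟨ solve 5 (λ m x y z w → x :- m :* y :- (z :- m :* w) := x :- z :- m :* (y :- w)) refl
         (fromℕ k) (E 1 (suc k)) (E 1 k) (E 0 (suc k)) (E 0 k) ⟩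
  D W k ∎

-- Written through g = `G k` and m = k, `E 0 k` is g(2m - 1) and `E 1 k` is g(4m² - 1), so both
-- sides equal m²g. Adding and subtracting `E 0` hides the negative `G 0` inside `E 0 ⊕ G`.
D-D-G : (¼ ⊙ (W ⊕ (E 0 ⊕ G))) ≗ D (D G)
D-D-G k = begin
  ¼ * (E 1 k - E 0 k + (E 0 k + g))
    ≡⟨ solve 3 (λ x y g → con ¼ :* (x :- y :+ (y :+ g)) := con ¼ :* (x :+ g)) refl (E 1 k) (E 0 k) g ⟩
  ¼ * (E 1 k + g)
    ≡⟨ cong (λ t → ¼ * (t + g)) E₁-G ⟩
  ¼ * (y * (1ℚ + (1ℚ + 1ℚ) * m) + g)
    ≡⟨ solve 2 (λ g m → let y = g :* (con (1ℚ + 1ℚ) :* m :- con 1ℚ) in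
         con ¼ :* (y :* (con 1ℚ :+ con (1ℚ + 1ℚ) :* m) :+ g) :=
         y :* (con 1ℚ :+ con (1ℚ + 1ℚ) :* m) :- (con 1ℚ :+ m) :* y :- m :* (y :- m :* g)) refl g m ⟩
  y * (1ℚ + (1ℚ + 1ℚ) * m) - (1ℚ + m) * y - m * (y - m * g)
    ≡⟨ cong₂ (λ s t → s - (1ℚ + m) * t - m * (t - m * g)) E₁-G (E₀-G k) ⟨
  E 1 k - (1ℚ + m) * E 0 k - m * (E 0 k - m * g)
    ≡⟨ cong (λ s → E 1 k - s * E 0 k - m * (E 0 k - m * g)) (fromℕ-suc k) ⟨
  D (D G) k ∎
  where
  g = G k
  m = fromℕ k
  y = g * ((1ℚ + 1ℚ) * m - 1ℚ)
  E₁-G : E 1 k ≡ y * (1ℚ + (1ℚ + 1ℚ) * m)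
  E₁-G = trans (oddProduct-step k) (cong (_* (1ℚ + (1ℚ + 1ℚ) * m)) (E₀-G k))

D-E₀⊕G : (½ ⊙ (E 1 ⊕ E 0) ⊕ D G) ≗ D (E 0 ⊕ G)
D-E₀⊕G k = begin
  ½ * (E 1 k + E 0 k) + D G k
    ≡⟨ cong (λ t → ½ * (E 1 k + t) + D G k) (*-identityˡ (E 0 k)) ⟨
  ½ * (E 1 k + 1ℚ * E 0 k) + D G k
    ≡⟨ cong (_+ D G k) (D-E 0 k) ⟩
  D (E 0) k + D G k
    ≡⟨ D-⊕ (E 0) G k ⟩
  D (E 0 ⊕ G) k ∎

-- The system has nonnegative coefficients. Since `D (E j)` involves `E (suc j)`, the whole family
-- of `E j` has to be among the generators.
D-cone : ∀ {c} → Cone c → Cone (D c)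
D-cone (E-cone j) = ≗-cone (D-E j) (⊙-cone ½-nonNeg (⊕-cone (E-cone (suc j))
  (⊙-cone (+-nonNeg (fromℕ-nonNeg 1) (*-nonNeg (fromℕ-nonNeg 2) (fromℕ-nonNeg j))) (E-cone j))))
D-cone W-cone  = ≗-cone D-W (⊙-cone ½-nonNeg (⊕-cone (⊕-cone (E-cone 2) (E-cone 1)) W-cone))
D-cone DG-cone = ≗-cone D-D-G (⊙-cone ¼-nonNeg (⊕-cone W-cone EG-cone))
D-cone EG-cone = ≗-cone D-E₀⊕G (⊕-cone (⊙-cone ½-nonNeg (⊕-cone (E-cone 1) (E-cone 0))) DG-cone)
D-cone (⊕-cone {a} {b} ca cb)   = ≗-cone (D-⊕ a b) (⊕-cone (D-cone ca) (D-cone cb))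
D-cone (⊙-cone {q} {a} 0≤q ca) = ≗-cone (D-⊙ q a) (⊙-cone 0≤q (D-cone ca))
D-cone (≗-cone a≗b ca)          = ≗-cone (D-cong a≗b) (D-cone ca)

-- Nonnegativity of the Taylor coefficients.

cone-0 : ∀ {c} → Cone c → 0ℚ ≤ c 0
cone-0 (E-cone j)      = fromℕ-nonNeg (oddProduct (j ℕ.+ 0))
-- The initial values compute: `W 0` = 1 - 1, `D G 0` = `G 1` = 1, and `E 0 0 + G 0` = 1 - 1.
cone-0 W-cone          = ≤-refl
cone-0 DG-cone         = fromℕ-nonNeg 1
cone-0 EG-cone         = ≤-refl
cone-0 (⊕-cone ca cb)  = +-nonNeg (cone-0 ca) (cone-0 cb)
cone-0 (⊙-cone 0≤q ca) = *-nonNeg 0≤q (cone-0 ca)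
cone-0 (≗-cone a≗b ca) = subst (0ℚ ≤_) (a≗b 0) (cone-0 ca)

-- Iterating `T-suc` makes `T n c` the value at 0 of the n-fold `D` of `c`, which stays in the cone.
T-cone : ∀ n {c} → Cone c → 0ℚ ≤ T n c
T-cone zero    {c} cc = subst (0ℚ ≤_) (sym (T-zero c)) (cone-0 cc)
T-cone (suc n) {c} cc = subst (0ℚ ≤_) (sym (T-suc n c)) (T-cone n (D-cone cc))

theorem6p4 : (n : ℕ) → n ℕ.≥ 1 → 0ℚ ≤ d n
theorem6p4 n@(suc m) _ = subst (0ℚ ≤_)
  (solve 3 (λ r s t → r :* (s :* t) := s :* r :* t) refl
    (1/ n !) (sgn n) (∑≤ n (λ k → sgn k * S n k * G k)))
  -- `G` is outside the cone, as `G 0` = -1; one application of `T-suc` replaces it by `D G`, which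
  -- is a generator.
  (*-nonNeg (1/!-nonNeg n) (subst (0ℚ ≤_) (sym (T-suc m G)) (T-cone m DG-cone)))
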